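{- For every formula $A$ of $\mathbf{L_1}$, if $TA$ is valid in first-order predicate logic with equality, then it is not the case that $\dashv_H A$.
   Context: Formulas of $\mathbf{L_1}$: built from atomic formulas $\epsilon ab$ ($a,b$ name variables, possibly equal) with primitive connectives $\vee,\sim$; $\wedge,\supset,\equiv$ defined as usual. Disjunctions may be associated in any way. $\vdash_H A$: $A$ belongs to the smallest set containing all instances of classical propositional tautologies and all formulas $\epsilon ab\supset\epsilon aa$, $(\epsilon ab\wedge\epsilon bc)\supset\epsilon ac$, $(\epsilon ab\wedge\epsilon bb)\supset\epsilon ba$, closed under modus ponens. Positive/negative parts (occurrences): $A$ is a positive part of $A$; if $B\vee C$ is a positive part then $B,C$ are positive parts; if $\sim B$ is a positive part then $B$ is a negative part; if $\sim B$ is a negative part then $B$ is a positive part. $F[B_+,B_-]$ denotes a formula in which some $B$ has one occurrence as positive part and another non-overlapping occurrence as negative part. Hintikka formula: a formula $H$ such that (1) $H$ is not of the form $F[B_+,B_-]$; (2) if $B\vee C$ is a negative part of $H$ then $B$ or $C$ is; (3) if $\epsilon ab$ is a negative part then so is $\epsilon aa$; (4) if $\epsilon ab,\epsilon bc$ are negative parts then so is $\epsilon ac$; (5) if $\epsilon ab,\epsilon bb$ are negative parts then so is $\epsilon ba$. $\mathbf{HAR}$: fix a name variable $a_0$; $\dashv_H$ is the smallest set such that $\dashv_H\epsilon a_0a_0$; $\dashv_H\sim\epsilon a_0a_0$; if $\vdash_H A\supset B$ and $\dashv_H B$ then $\dashv_H A$; if $\dashv_H A$ and $A$ is obtained from $B$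 by uniform substitution of name variables for name variables then $\dashv_H B$; if $A$ is a Hintikka formula that is a disjunction of atomic or negated atomic formulas, $\dashv_H A$, and $\epsilon ab$ is not a negative part of $A$, then $\dashv_H A\vee\epsilon ab$. Translation $T$ into first-order logic with equality, with a monadic predicate $F_a$ for each name variable $a$: $T\epsilon ab=\exists x(F_ax\wedge F_bx)\wedge\forall x\forall y(F_ax\wedge F_ay\supset x=y)$; $T(A\vee B)=TA\vee TB$; $T(\sim A)=\sim TA$. Valid: true in every structure with nonempty domain and $=$ as identity. -}

module Defs where

open import Data.Bool using (Bool; true; not) renaming (_∨_ to _or_)
open import Data.Fin using (Fin; zero; suc)
open import Data.Nat using (ℕ)
open import Data.Product using (Σ; ∃; _×_)
open import Data.Sum using (_⊎_)
open import Data.Vec using (Vec; []; _∷_; lookup)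
open import Relation.Binary.PropositionalEquality using (_≡_)
open import Relation.Nullary using (¬_)

Name : Set
Name = ℕ

infix  9 ~_
infixr 7 _∧_
infixr 6 _∨_
infixr 5 _⊃_

data Formula : Set where
  ε   : Name → Name → Formula
  _∨_ : Formula → Formula → Formula
  ~_  : Formula → Formula

_∧_ : Formula → Formula → Formula
A ∧ B = ~ (~ A ∨ ~ B)

_⊃_ : Formula → Formula → Formula
A ⊃ B = ~ A ∨ B

rename : (Name → Name) → Formula → Formula
rename σ (ε a b) = ε (σ a) (σ b)
rename σ (A ∨ B) = rename σ A ∨ rename σ B
rename σ (~ A)   = ~ rename σ A

data PropFormula : Set where
  varₚ : ℕ → PropFormula
  _∨ₚ_ : PropFormula → PropFormula → PropFormula
  ~ₚ_  : PropFormula → PropFormula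

eval : (ℕ → Bool) → PropFormula → Bool
eval v (varₚ i) = v i
eval v (p ∨ₚ q) = eval v p or eval v q
eval v (~ₚ p)   = not (eval v p)

Tautology : PropFormula → Set
Tautology p = ∀ v → eval v p ≡ true

instantiate : (ℕ → Formula) → PropFormula → Formula
instantiate τ (varₚ i) = τ i
instantiate τ (p ∨ₚ q) = instantiate τ p ∨ instantiate τ q
instantiate τ (~ₚ p)   = ~ instantiate τ p

infix 3 ⊢H_

data ⊢H_ : Formula → Set where
  taut  : ∀ p (τ : ℕ → Formula) → Tautology p → ⊢H instantiate τ p
  ax₁   : ∀ a b → ⊢H ε a b ⊃ ε a a
  ax₂   : ∀ a b c → ⊢H (ε a b ∧ ε b c) ⊃ ε a c
  ax₃   : ∀ a b → ⊢H (ε a b ∧ ε b b) ⊃ ε b a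
  mp    : ∀ {A B} → ⊢H A ⊃ B → ⊢H A → ⊢H B

data Sign : Set where
  pos neg : Sign

-- An element of Part A s B is an occurrence of B in A as a part of sign s:
-- its constructors spell out the path from the root of A to the occurrence.
data Part (A : Formula) : Sign → Formula → Set where
  whole : Part A pos A
  left  : ∀ {B C} → Part A pos (B ∨ C) → Part A pos B
  right : ∀ {B C} → Part A pos (B ∨ C) → Part A pos C
  flip⁺ : ∀ {B} → Part A pos (~ B) → Part A neg B
  flip⁻ : ∀ {B} → Part A neg (~ B) → Part A pos B

-- p Within q: the occurrence p lies inside (or is) the occurrence q,
-- i.e. the path q is an initial segment of the path p.
data _Within_ {A : Formula} {t : Sign} {D : Formula} : {s : Sign} {B : Formula} → Part A s B → Part A t D → Set where
  here     : {q : Part A t D} → q Within q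
  in-left  : ∀ {B C} {p : Part A pos (B ∨ C)} {q : Part A t D} → p Within q → left p Within q
  in-right : ∀ {B C} {p : Part A pos (B ∨ C)} {q : Part A t D} → p Within q → right p Within q
  in-flip⁺ : ∀ {B} {p : Part A pos (~ B)} {q : Part A t D} → p Within q → flip⁺ p Within q
  in-flip⁻ : ∀ {B} {p : Part A neg (~ B)} {q : Part A t D} → p Within q → flip⁻ p Within q

Overlapping : ∀ {A s t B C} → Part A s B → Part A t C → Set
Overlapping p q = p Within q ⊎ q Within p

-- A is of the form F[B₊,B₋] for some B.
HasClash : Formula → Set
HasClash A = ∃ λ B → Σ (Part A pos B) λ p → Σ (Part A neg B) λ q → ¬ Overlapping p q

record Hintikka (H : Formula) : Set where
  field
    no-clash : ¬ HasClash H
    disj     : ∀ {B C} → Part H neg (B ∨ C) → Part H neg B ⊎ Part H neg C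
    refl-ε   : ∀ {a b} → Part H neg (ε a b) → Part H neg (ε a a)
    trans-ε  : ∀ {a b c} → Part H neg (ε a b) → Part H neg (ε b c) → Part H neg (ε a c)
    sym-ε    : ∀ {a b} → Part H neg (ε a b) → Part H neg (ε b b) → Part H neg (ε b a)

data Literal : Formula → Set where
  atom  : ∀ a b → Literal (ε a b)
  natom : ∀ a b → Literal (~ ε a b)

-- Disjunctions of literals, with one or more disjuncts, associated in any way.
data LiteralDisjunction : Formula → Set where
  literal : ∀ {A} → Literal A → LiteralDisjunction A
  _or-lit_ : ∀ {A B} → LiteralDisjunction A → LiteralDisjunction B → LiteralDisjunction (A ∨ B)

infix 3 _⊣H_

-- a₀ ⊣H A: A is rejected in HAR, where a₀ is the name variable fixed in the
-- two rejection axioms.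
data _⊣H_ (a₀ : Name) : Formula → Set where
  rej-pos : a₀ ⊣H ε a₀ a₀
  rej-neg : a₀ ⊣H ~ ε a₀ a₀
  rej-mp  : ∀ {A B} → ⊢H A ⊃ B → a₀ ⊣H B → a₀ ⊣H A
  rej-sub : ∀ {B} (σ : Name → Name) → a₀ ⊣H rename σ B → a₀ ⊣H B
  rej-ε   : ∀ {A a b} → Hintikka A → LiteralDisjunction A → a₀ ⊣H A →
            ¬ Part A neg (ε a b) → a₀ ⊣H A ∨ ε a b

infix  9 ~ᶠ_
infix  8 _≐_
infixr 7 _∧ᶠ_
infixr 6 _∨ᶠ_
infixr 5 _⊃ᶠ_

-- First-order formulas over the signature {F a | a : Name} with equality, with
-- free (de Bruijn) variables among Fin n.
data FO (n : ℕ) : Set where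
  F    : Name → Fin n → FO n
  _≐_  : Fin n → Fin n → FO n
  ~ᶠ_  : FO n → FO n
  _∧ᶠ_ _∨ᶠ_ _⊃ᶠ_ : FO n → FO n → FO n
  ∀ᶠ ∃ᶠ : FO (ℕ.suc n) → FO n

record Structure : Set₁ where
  field
    Domain    : Set
    inhabited : Domain
    ⟦_⟧       : Name → Domain → Set

-- Classical truth in a structure.  Atomic formulas, disjunctions and
-- existentials carry a double negation so that every satisfaction statement is
-- ¬¬-stable and all classical laws hold; the remaining clauses preserve
-- stability.  Under excluded middle this is the usual Tarskian definition,
-- whereas the unguarded clauses would define intuitionistic truth.
_,_⊨_ : (M : Structure) → ∀ {n} → Vec (Structure.Domain M) n → FO n → Set
M , ρ ⊨ F a x    = ¬ ¬ Structure.⟦_⟧ M a (lookup ρ x)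
M , ρ ⊨ (x ≐ y)  = ¬ ¬ (lookup ρ x ≡ lookup ρ y)
M , ρ ⊨ (~ᶠ φ)   = ¬ (M , ρ ⊨ φ)
M , ρ ⊨ (φ ∧ᶠ ψ) = (M , ρ ⊨ φ) × (M , ρ ⊨ ψ)
M , ρ ⊨ (φ ∨ᶠ ψ) = ¬ ¬ ((M , ρ ⊨ φ) ⊎ (M , ρ ⊨ ψ))
M , ρ ⊨ (φ ⊃ᶠ ψ) = (M , ρ ⊨ φ) → (M , ρ ⊨ ψ)
M , ρ ⊨ ∀ᶠ φ     = (d : Structure.Domain M) → M , (d ∷ ρ) ⊨ φ
M , ρ ⊨ ∃ᶠ φ     = ¬ ¬ (Σ (Structure.Domain M) λ d → M , (d ∷ ρ) ⊨ φ)

Valid : FO 0 → Set₁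
Valid φ = (M : Structure) → M , [] ⊨ φ

T : Formula → FO 0
T (ε a b) = ∃ᶠ (F a zero ∧ᶠ F b zero)
         ∧ᶠ ∀ᶠ (∀ᶠ (F a (suc zero) ∧ᶠ F a zero ⊃ᶠ suc zero ≐ zero))
T (A ∨ B) = T A ∨ᶠ T B
T (~ A)   = ~ᶠ T A

{-# OPTIONS --safe #-}
-- Call a decidable relation R on names a model if it satisfies the three
-- axioms on ε.  Every rejected formula is false in some model: the rejection
-- rules for ⊢H and for substitution preserve this, and for A ∨ ε a b with A
-- Hintikka one lets R c d mean that ε c d is a negative part of A.  Conversely,
-- every model arises from a first-order structure through T.  There R is an
-- equivalence relation on the singular names (those a with R a a); a singular
-- name denotes (the least representative of) its class, and any other name b
-- denotes the classes of the x with R x b, together with two extra points which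
-- keep b from being singular.
module Submission where

open import Defs

open import Data.Bool using (Bool; true; false; not) renaming (_∨_ to _or_)
open import Data.Empty using (⊥)
open import Data.Fin using (zero; suc)
open import Data.Nat using (_<_; _≟_)
open import Data.Nat.Induction using (<-rec)
open import Data.Nat.Properties using (<-cmp)
open import Data.Product using (Σ; ∃; _×_; _,_)
open import Data.Sum using (_⊎_; inj₁; inj₂; [_,_]′)
open import Data.Unit using (⊤; tt)
open import Data.Vec using ([])
open import Function using (_∘_)
open import Relation.Binary.Definitions using (tri<; tri≈; tri>)
open import Relation.Binary.PropositionalEquality using (_≡_; refl; cong; cong₂; trans)
open import Relation.Nullary using (¬_; Dec; yes; no; does; proof; contradiction)
open import Relation.Nullary.Decidable using (map′; _×-dec_; _⊎-dec_; dec-true; dec-false; decidable-stable)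
open import Relation.Nullary.Reflects using (Reflects; ofʸ; ofⁿ; ¬-reflects)

record Model : Set₁ where
  field
    R       : Name → Name → Set
    R?      : ∀ a b → Dec (R a b)
    R-refl  : ∀ {a b} → R a b → R a a
    R-trans : ∀ {a b c} → R a b → R b c → R a c
    R-sym   : ∀ {a b} → R a b → R b b → R b a

  value : Formula → Bool
  value (ε a b) = does (R? a b)
  value (A ∨ B) = value A or value B
  value (~ A)   = not (value A)

open Model using (value)

-- Matches the doubly negated clause for `∨ᶠ`; the Boolean values settle the case split, so no
-- excluded middle is required.
¬¬⊎-reflects : ∀ {P Q : Set} {b c} → Reflects P b → Reflects Q c → Reflects (¬ ¬ (P ⊎ Q)) (b or c)
¬¬⊎-reflects (ofʸ p)  _        = ofʸ λ ¬p⊎q → ¬p⊎q (inj₁ p)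
¬¬⊎-reflects (ofⁿ _)  (ofʸ q)  = ofʸ λ ¬p⊎q → ¬p⊎q (inj₂ q)
¬¬⊎-reflects (ofⁿ ¬p) (ofⁿ ¬q) = ofⁿ λ ¬¬p⊎q → ¬¬p⊎q [ ¬p , ¬q ]′

module _ (𝓜 : Model) where
  open Model 𝓜 hiding (value)

  value-instantiate : ∀ τ p → value 𝓜 (instantiate τ p) ≡ eval (value 𝓜 ∘ τ) p
  value-instantiate τ (varₚ i) = refl
  value-instantiate τ (p ∨ₚ q) = cong₂ _or_ (value-instantiate τ p) (value-instantiate τ q)
  value-instantiate τ (~ₚ p)   = cong not (value-instantiate τ p)

  value-mp : ∀ A B → value 𝓜 (A ⊃ B) ≡ true → value 𝓜 A ≡ true → value 𝓜 B ≡ true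
  value-mp A B A⊃B A-true with value 𝓜 A
  value-mp A B A⊃B refl | true = A⊃B

  value-mt : ∀ A B → value 𝓜 (A ⊃ B) ≡ true → value 𝓜 B ≡ false → value 𝓜 A ≡ false
  value-mt A B A⊃B B-false with value 𝓜 A | value 𝓜 B
  value-mt A B ()  refl | true  | false
  value-mt A B A⊃B refl | false | false = refl

  ⊢H-sound : ∀ {A} → ⊢H A → value 𝓜 A ≡ true
  ⊢H-sound (taut p τ p-taut) = trans (value-instantiate τ p) (p-taut (value 𝓜 ∘ τ))
  ⊢H-sound (ax₁ a b) with R? a b
  ... | no  _   = refl
  ... | yes Rab = dec-true (R? a a) (R-refl Rab)
  ⊢H-sound (ax₂ a b c) with R? a b | R? b c
  ... | no  _   | _       = refl
  ... | yes _   | no  _   = refl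
  ... | yes Rab | yes Rbc = dec-true (R? a c) (R-trans Rab Rbc)
  ⊢H-sound (ax₃ a b) with R? a b | R? b b
  ... | no  _   | _       = refl
  ... | yes _   | no  _   = refl
  ... | yes Rab | yes Rbb = dec-true (R? b a) (R-sym Rab Rbb)
  ⊢H-sound (mp {A} {B} d e)  = value-mp A B (⊢H-sound d) (⊢H-sound e)

  -- Handles `rej-sub`: a model falsifying `rename σ B` pulls back to one falsifying `B`.
  pullback : (Name → Name) → Model
  pullback σ = record
    { R       = λ a b → R (σ a) (σ b)
    ; R?      = λ a b → R? (σ a) (σ b)
    ; R-refl  = R-refl
    ; R-trans = R-trans
    ; R-sym   = R-sym
    }

  value-rename : ∀ σ A → value (pullback σ) A ≡ value 𝓜 (rename σ A)
  value-rename σ (ε a b) = refl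
  value-rename σ (A ∨ B) = cong₂ _or_ (value-rename σ A) (value-rename σ B)
  value-rename σ (~ A)   = cong not (value-rename σ A)

  Least : Name → Set
  Least x = ∀ {y} → y < x → ¬ R y x

  -- Least representatives stand in for a quotient: a point `inj₁ x` with `x` not singular or not
  -- least satisfies no predicate.
  structure : Structure
  structure = record
    { Domain    = Name ⊎ Bool
    ; inhabited = inj₂ true
    ; ⟦_⟧       = λ { a (inj₁ x) → R x a × Least x ; a (inj₂ _) → ¬ R a a }
    }

  -- Were there no such `x`, strong induction would refute every `R x a`, in particular `R a a`: a
  -- smaller `y` with `R y x` has `R y a` by transitivity.
  ¬¬∃-least : ∀ {a} → R a a → ¬ ¬ (∃ λ x → R x a × Least x)
  ¬¬∃-least {a} Raa none = <-rec (λ x → ¬ R x a)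
    (λ x ih Rxa → none (x , Rxa , λ y<x Ryx → ih y<x (R-trans Ryx Rxa))) a Raa

  -- Going through `a` relates `x` and `y` in both directions, so the smaller would contradict the
  -- leastness of the larger.
  least-unique : ∀ {a x y} → R a a → R x a → Least x → R y a → Least y → x ≡ y
  least-unique {_} {x} {y} Raa Rxa x-least Rya y-least with <-cmp x y
  ... | tri< x<y _ _ = contradiction (R-trans Rxa (R-sym Rya Raa)) (y-least x<y)
  ... | tri≈ _ x≡y _ = x≡y
  ... | tri> _ _ y<x = contradiction (R-trans Rya (R-sym Rxa Raa)) (x-least y<x)

  ⊨ε : ∀ {a b} → R a b → structure , [] ⊨ T (ε a b)
  ⊨ε {a} {b} Rab = nonempty , unique
    where
    Raa = R-refl Rab

    nonempty : structure , [] ⊨ ∃ᶠ (F a zero ∧ᶠ F b zero)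
    -- The witness is the least representative of the class of `a`; transitivity puts it under `b`
    -- too.
    nonempty none = ¬¬∃-least Raa λ (x , Rxa , x-least) →
      none (inj₁ x , (λ ∉a → ∉a (Rxa , x-least)) , (λ ∉b → ∉b (R-trans Rxa Rab , x-least)))

    unique : structure , [] ⊨ ∀ᶠ (∀ᶠ (F a (suc zero) ∧ᶠ F a zero ⊃ᶠ suc zero ≐ zero))
    unique (inj₁ x) (inj₁ y) (x∈a , y∈a) x≢y = x∈a λ (Rxa , x-least) → y∈a λ (Rya , y-least) →
      x≢y (cong inj₁ (least-unique Raa Rxa x-least Rya y-least))
    unique (inj₁ _) (inj₂ _) (_ , j∈a) _ = j∈a λ ¬Raa → ¬Raa Raa
    unique (inj₂ _) _        (i∈a , _) _ = i∈a λ ¬Raa → ¬Raa Raa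

  ⊨ε⁻¹ : ∀ {a b} → structure , [] ⊨ T (ε a b) → R a b
  ⊨ε⁻¹ {a} {b} (nonempty , unique) = decidable-stable (R? a b) λ ¬Rab → nonempty λ where
      (inj₁ x , x∈a , x∈b) → x∈a λ (Rxa , _) → x∈b λ (Rxb , _) → ¬Rab (R-trans (R-sym Rxa Raa) Rxb)
      (inj₂ _ , i∈a , _)   → i∈a λ ¬Raa → ¬Raa Raa
    where
    Raa : R a a
    -- If `a` were not singular, both extra points would satisfy its predicate, and uniqueness would
    -- identify them.
    Raa = decidable-stable (R? a a) λ ¬Raa →
      unique (inj₂ true) (inj₂ false) ((λ ∉a → ∉a ¬Raa) , (λ ∉a → ∉a ¬Raa)) λ ()

  value-reflects-⊨ : ∀ A → Reflects (structure , [] ⊨ T A) (value 𝓜 A)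
  value-reflects-⊨ (ε a b) = proof (map′ ⊨ε ⊨ε⁻¹ (R? a b))
  value-reflects-⊨ (A ∨ B) = ¬¬⊎-reflects (value-reflects-⊨ A) (value-reflects-⊨ B)
  value-reflects-⊨ (~ A)   = ¬-reflects (value-reflects-⊨ A)

  false⇒¬Valid : ∀ {A} → value 𝓜 A ≡ false → ¬ Valid (T A)
  false⇒¬Valid {A} A-false valid with value 𝓜 A | value-reflects-⊨ A
  false⇒¬Valid refl valid | false | ofⁿ ⊭A = ⊭A (valid structure)

_⨾_ : ∀ {A B C s} → Part A pos B → Part B s C → Part A s C
p ⨾ whole   = p
p ⨾ left q  = left (p ⨾ q)
p ⨾ right q = right (p ⨾ q)
p ⨾ flip⁺ q = flip⁺ (p ⨾ q)
p ⨾ flip⁻ q = flip⁻ (p ⨾ q)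

-- A `Part` path is extended at its far end, so its first step away from the root is hidden; this
-- view exposes it.
data ∨-Part (A B : Formula) : Sign → Formula → Set where
  root : ∨-Part A B pos (A ∨ B)
  in-A : ∀ {s C} → Part A s C → ∨-Part A B s C
  in-B : ∀ {s C} → Part B s C → ∨-Part A B s C

∨-part : ∀ {A B s C} → Part (A ∨ B) s C → ∨-Part A B s C
∨-part whole = root
∨-part (left p) with ∨-part p
... | root   = in-A whole
... | in-A q = in-A (left q)
... | in-B q = in-B (left q)
∨-part (right p) with ∨-part p
... | root   = in-B whole
... | in-A q = in-A (right q)
... | in-B q = in-B (right q)
∨-part (flip⁺ p) with ∨-part p
... | in-A q = in-A (flip⁺ q)
... | in-B q = in-B (flip⁺ q)
∨-part (flip⁻ p) with ∨-part p
... | in-A q = in-A (flip⁻ q)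
... | in-B q = in-B (flip⁻ q)

∨-part-neg : ∀ {A B C} → Part (A ∨ B) neg C → Part A neg C ⊎ Part B neg C
∨-part-neg p with ∨-part p
... | in-A q = inj₁ q
... | in-B q = inj₂ q

data LiteralPart : Formula → Sign → Formula → Set where
  self  : ∀ {A} → LiteralPart A pos A
  under : ∀ {a b} → LiteralPart (~ ε a b) neg (ε a b)

literal-part : ∀ {A s B} → Literal A → Part A s B → LiteralPart A s B
literal-part l whole = self
literal-part l (left p) with literal-part l p
literal-part () (left p) | self
literal-part l (right p) with literal-part l p
literal-part () (right p) | self
literal-part l (flip⁺ p) with literal-part l p
literal-part (natom a b) (flip⁺ p) | self = under
literal-part l (flip⁻ p) with literal-part l p
... | ()

-- Supplies `R?` for the model read off from `A`: the negative atoms are those of the negated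
-- literals, found by comparing names.
negative-atom? : ∀ {A} → LiteralDisjunction A → ∀ a b → Dec (Part A neg (ε a b))
negative-atom? (literal (atom c d)) a b = no λ p → contradiction (literal-part (atom c d) p) λ ()
negative-atom? (literal (natom c d)) a b =
  map′ (λ { (refl , refl) → flip⁺ whole }) (same ∘ literal-part (natom c d)) (c ≟ a ×-dec d ≟ b)
  where
  same : LiteralPart (~ ε c d) neg (ε a b) → c ≡ a × d ≡ b
  same under = refl , refl
negative-atom? (A-lit or-lit B-lit) a b =
  map′ [ left whole ⨾_ , right whole ⨾_ ]′ ∨-part-neg
       (negative-atom? A-lit a b ⊎-dec negative-atom? B-lit a b)

-- An atom has no proper parts, so the only path extending `q` is `q` itself. Hence occurrences of
-- an atom with opposite signs never overlap.
within-atom : ∀ {A s t B a b} {p : Part A s B} {q : Part A t (ε a b)} → p Within q → s ≡ t × B ≡ ε a b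
within-atom here = refl , refl
within-atom (in-left w) with within-atom w
... | _ , ()
within-atom (in-right w) with within-atom w
... | _ , ()
within-atom (in-flip⁺ w) with within-atom w
... | _ , ()
within-atom (in-flip⁻ w) with within-atom w
... | _ , ()

atom-clash : ∀ {A a b} → Part A pos (ε a b) → Part A neg (ε a b) → HasClash A
atom-clash {a = a} {b} p q = ε a b , p , q , λ where
  (inj₁ w) → contradiction (within-atom w) λ ()
  (inj₂ w) → contradiction (within-atom w) λ ()

module _ {A : Formula} (hin : Hintikka A) (A-lit : LiteralDisjunction A) where
  open Hintikka hin

  hintikkaModel : Model
  hintikkaModel = record
    { R       = λ a b → Part A neg (ε a b)
    ; R?      = negative-atom? A-lit
    ; R-refl  = refl-ε
    ; R-trans = trans-ε
    ; R-sym   = sym-ε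
    }

  -- Stated for all positive parts so that induction passes to the disjuncts. A positive atom is not
  -- also negative, by `no-clash`; a negated atom makes its own atom true.
  positive-part-false : ∀ {B} → LiteralDisjunction B → Part A pos B → value hintikkaModel B ≡ false
  positive-part-false (literal (atom a b)) p =
    dec-false (negative-atom? A-lit a b) (no-clash ∘ atom-clash p)
  positive-part-false (literal (natom a b)) p =
    cong not (dec-true (negative-atom? A-lit a b) (flip⁺ p))
  positive-part-false (B-lit or-lit C-lit) p =
    cong₂ _or_ (positive-part-false B-lit (left p)) (positive-part-false C-lit (right p))

  hintikka∨ε-false : ∀ {a b} → ¬ Part A neg (ε a b) → value hintikkaModel (A ∨ ε a b) ≡ false
  hintikka∨ε-false {a} {b} ¬neg =
    cong₂ _or_ (positive-part-false A-lit whole) (dec-false (negative-atom? A-lit a b) ¬neg)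

emptyModel : Model
emptyModel = record
  { R = λ _ _ → ⊥ ; R? = λ _ _ → no λ () ; R-refl = λ () ; R-trans = λ () ; R-sym = λ () }

fullModel : Model
fullModel = record
  { R = λ _ _ → ⊤ ; R? = λ _ _ → yes tt ; R-refl = λ _ → tt ; R-trans = λ _ _ → tt ; R-sym = λ _ _ → tt }

rejected⇒false : ∀ {a₀ A} → a₀ ⊣H A → Σ Model λ 𝓜 → value 𝓜 A ≡ false
rejected⇒false rej-pos = emptyModel , refl
rejected⇒false rej-neg = fullModel , refl
rejected⇒false (rej-mp {A} {B} ⊢A⊃B rej) =
  let 𝓜 , B-false = rejected⇒false rej in 𝓜 , value-mt 𝓜 A B (⊢H-sound 𝓜 ⊢A⊃B) B-false
rejected⇒false (rej-sub {B} σ rej) =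
  let 𝓜 , σB-false = rejected⇒false rej in pullback 𝓜 σ , trans (value-rename 𝓜 σ B) σB-false
-- The model comes from `A` itself: the new disjunct is false there because it is not a negative
-- part.
rejected⇒false (rej-ε hin A-lit _ ¬neg) = hintikkaModel hin A-lit , hintikka∨ε-false hin A-lit ¬neg

theorem6p1 : (a₀ : Name) (A : Formula) → Valid (T A) → ¬ (a₀ ⊣H A)
theorem6p1 a₀ A valid rej =
  let 𝓜 , A-false = rejected⇒false rej in false⇒¬Valid 𝓜 A-false valid
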